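{- There exists an absolute constant $C>0$ such that the following holds. Let $0<\varepsilon<1/4$ and let $t,n$ be positive integers with $n>\varepsilon^{ -Ct}$. Then every red/blue colouring of the edges of the complete graph $K_n$ in which every vertex is incident to at least $n/4+\varepsilon n$ red edges and at least $n/4+\varepsilon n$ blue edges contains an induced copy of $K_{t,t}$ in some colour: there exist disjoint vertex sets $P,Q$ with $|P|=|Q|=t$ and a colour $c\in\{\text{red},\text{blue}\}$ such that every edge between $P$ and $Q$ has colour $c$ and every edge with both endpoints in $P$, or both endpoints in $Q$, has the other colour.
   Context: A 2-colouring of $K_n$ assigns each edge of the complete graph on $n$ vertices one of the colours red or blue. The red (resp. blue) degree of a vertex is the number of red (resp. blue) edges incident to it. -}

module Defs where

open import Data.Nat using (ℕ)
open import Data.Bool using (Bool; true; false; not)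
open import Data.Fin using (Fin; _≟_)
open import Data.List using (List; length; filter)
open import Data.List.Base using ()
open import Data.Fin.Base using ()
open import Data.List using (allFin)
open import Data.Product using (_×_)
open import Relation.Binary.PropositionalEquality using (_≡_; _≢_)
open import Relation.Nullary.Decidable using (¬?; _×-dec_)
import Data.Bool.Properties as BoolP

-- A red/blue edge colouring of K_n: colour of edge {i,j} (i ≠ j).
-- We use  true = red,  false = blue.  Values on the diagonal are irrelevant.
Colouring : ℕ → Set
Colouring n = Fin n → Fin n → Bool

IsSymmetric : ∀ {n} → Colouring n → Set
IsSymmetric {n} c = ∀ (i j : Fin n) → c i j ≡ c j i

degree : ∀ {n} → Colouring n → Bool → Fin n → ℕ
degree {n} c b v =
  length (filter (λ j → ¬? (j ≟ v) ×-dec (c v j BoolP.≟ b)) (allFin n))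

{-# OPTIONS --safe #-}
module Submission where

-- Assume there is no pattern. If S is a (not b)-clique, few vertices y of a set Y
-- in which all large subsets contain a (not b)-clique of size t can send t or more
-- b-edges to S: otherwise, by pigeonhole, some t-subset of S would have a large
-- common b-neighbourhood in Y. Covering a set X by such cliques S shows that there
-- are few b-edges between X and Y.
-- With X = Y this bounds both colours at once, so every large set contains a
-- subset of a fixed size L, a block, which misses the 4t-cliques of some colour b.
-- By off-diagonal Ramsey a block is rich in (not b)-cliques of size t/ε, hence
-- the b-density between two blocks missing the same colour is O(ε). So up to a
-- small remainder the vertex set is A ∪ B with A almost all red and B almost all
-- blue. The blue degrees in A and the red degrees in B are then essentially spent
-- on the pairs in A × B, of which there are at most n²/4 < (1/4 + ε) n².

open import Defs
open import Data.Nat using (ℕ; zero; suc; _+_; _*_; _^_; _≤_; _<_; _≤?_; z≤n; s≤s; NonZero; >-nonZero) renaming (_≟_ to _≟ⁿ_)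
open import Data.Nat.DivMod using (_/_; m%n<n; m/n*n≤m; m*n/n≡m; m≡m%n+[m/n]*n; /-monoˡ-≤)
open import Data.Nat.Properties hiding (_≟_)
open import Data.Nat.Combinatorics using (_C_; nCn≡1; nCk≡nC[n∸k]; nCk+nC[k+1]≡[n+1]C[k+1])
open import Data.Nat.ListAction using (sum)
open import Data.Nat.ListAction.Properties using (sum-↭; sum-++)
open import Data.Nat.Tactic.RingSolver using (solve-∀)
open import Data.Bool using (Bool; true; false; not)
open import Data.Bool.Properties using (not-¬; ¬-not) renaming (_≟_ to _≟ᵇ_)
open import Data.Fin using (Fin; _≟_) renaming (zero to fzero; suc to fsuc)
open import Data.Fin.Properties using (all?)
open import Data.Fin.Subset using (Subset; _∈_; _∉_; ∣_∣; ⁅_⁆; _∪_) renaming (⊥ to ∅)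
open import Data.Fin.Subset.Properties using (anySubset?; _∈?_; ∉⊥; ∣⊥∣≡0; x∈⁅y⁆⇒x≡y; x∈p∪q⁻; ∪-identityˡ)
import Data.Vec as Vec
open import Data.List using (List; []; _∷_; _++_; length; filter; map; concat; take; allFin)
open import Data.List.Properties using (length-++; filter-++; filter-accept; filter-reject; length-filter; map-++; length-take; length-tabulate; ++-assoc)
open import Data.List.Membership.Propositional using () renaming (_∈_ to _∈ˡ_)
open import Data.List.Relation.Unary.Any using (here; there)
open import Data.List.Relation.Unary.All as All using (All; []; _∷_)
open import Data.List.Relation.Unary.All.Properties using (all-filter)
open import Data.List.Relation.Unary.AllPairs as AllPairs using (AllPairs; []; _∷_)
open import Data.List.Relation.Unary.Unique.Propositional using (Unique)
open import Data.List.Relation.Unary.Unique.Propositional.Properties using (allFin⁺)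
open import Data.List.Relation.Binary.Sublist.Propositional using (_⊆_; []; _∷_; _∷ʳ_; ⊆-trans; ⊆-refl; minimum)
open import Data.List.Relation.Binary.Sublist.Propositional.Properties using (All-resp-⊆; filter-⊆; take-⊆)
open import Data.List.Relation.Binary.Permutation.Propositional using (_↭_; ↭-refl; ↭-sym; ↭-trans; prep; ↭-reflexive)
open import Data.List.Relation.Binary.Permutation.Propositional.Properties using (↭-length; filter-↭; map⁺; shift; shifts; ++⁺ˡ)
open import Data.Product using (_×_; ∃-syntax; _,_; proj₁; proj₂)
open import Data.Sum using (_⊎_; inj₁; inj₂)
open import Data.Empty using (⊥; ⊥-elim)
open import Function using (_∘_; case_of_)
open import Level using (0ℓ)
open import Relation.Nullary using (¬_; Dec; yes; no; contradiction)
open import Relation.Nullary.Decidable using (¬?; _×-dec_; _⊎-dec_; _→-dec_; map′; decidable-stable)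
open import Relation.Unary using (Pred; Decidable)
open import Relation.Unary.Properties using (∁?)
open import Relation.Binary using (Rel)
open import Relation.Binary.PropositionalEquality using (_≡_; _≢_; refl; sym; trans; cong; cong₂; subst; subst₂; ≢-sym)

-- Binomial coefficients, pigeonhole for sums, and sublists.

nC0≡1 : ∀ n → n C 0 ≡ 1
nC0≡1 n = trans (nCk≡nC[n∸k] {0} {n} z≤n) (nCn≡1 n)

C-positive : ∀ {n k} → k ≤ n → 0 < n C k
C-positive {n} {zero} z≤n rewrite nC0≡1 n = s≤s z≤n
C-positive {suc n} {suc k} (s≤s k≤n) rewrite sym (nCk+nC[k+1]≡[n+1]C[k+1] n k) =
  ≤-trans (C-positive k≤n) (m≤m+n _ _)

-- The slack of one pays for the vertex that each step of Ramsey's recursion spends.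
sum-≤⇒⊎ : ∀ a b {c d} → a + b ≤ suc (c + d) → a ≤ c ⊎ b ≤ d
sum-≤⇒⊎ a b {c} {d} le with a ≤? c | b ≤? d
... | yes p | _ = inj₁ p
... | no _ | yes p = inj₂ p
... | no p | no r = contradiction
  (≤-trans (≤-reflexive (cong suc (sym (+-suc c d)))) (+-mono-≤ (≰⇒> p) (≰⇒> r)))
  (<⇒≱ (s≤s le))

sum-<⇒⊎ : ∀ a b {c d} → a + b < c + d → a < c ⊎ b < d
sum-<⇒⊎ a b lt = sum-≤⇒⊎ (suc a) (suc b) (≤-trans (≤-reflexive (cong suc (+-suc a b))) (s≤s lt))

+-exchange : ∀ p q r s → (p + q) + (r + s) ≡ (p + r) + (q + s)
+-exchange = solve-∀

module _ {A : Set} where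

  AllPairs-resp-⊆ : ∀ {R : Rel A 0ℓ} {xs ys : List A} → xs ⊆ ys → AllPairs R ys → AllPairs R xs
  AllPairs-resp-⊆ [] [] = []
  AllPairs-resp-⊆ (_ ∷ʳ s) (_ ∷ ps) = AllPairs-resp-⊆ s ps
  AllPairs-resp-⊆ (refl ∷ s) (p ∷ ps) = All-resp-⊆ s p ∷ AllPairs-resp-⊆ s ps

  length-filter-∁ : ∀ {P : Pred A 0ℓ} (P? : Decidable P) xs →
    length xs ≡ length (filter P? xs) + length (filter (∁? P?) xs)
  length-filter-∁ P? [] = refl
  length-filter-∁ P? (x ∷ xs) with P? x
  ... | yes _ = cong suc (length-filter-∁ P? xs)
  ... | no _ = trans (cong suc (length-filter-∁ P? xs)) (sym (+-suc _ _))

  -- Edge counts only see lists up to permutation, while richness and uniqueness pass to sublists;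
  -- so the rest is returned in both forms.
  ⊆-complement : ∀ {xs ys : List A} → xs ⊆ ys → ∃[ zs ] (zs ⊆ ys × ys ↭ xs ++ zs)
  ⊆-complement [] = [] , [] , ↭-refl
  ⊆-complement {xs} (y ∷ʳ s) with ⊆-complement s
  ... | zs , zs⊆ , π = y ∷ zs , refl ∷ zs⊆ , ↭-trans (prep y π) (↭-sym (shift y xs zs))
  ⊆-complement (_∷_ {x} refl s) with ⊆-complement s
  ... | zs , zs⊆ , π = zs , x ∷ʳ zs⊆ , prep x π

-- Degrees and edge counts in one colour.

module Edges {n : ℕ} (c : Colouring n) (c-sym : IsSymmetric c) where

  V : Set
  V = Fin n

  Adj : Bool → V → V → Set
  Adj b v j = j ≢ v × c v j ≡ b

  -- Built exactly as in `degree`, so that `deg b v (allFin n)` and `degree c b v` agree by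
  -- definition.
  Adj? : ∀ b v → Decidable (Adj b v)
  Adj? b v j = ¬? (j ≟ v) ×-dec (c v j ≟ᵇ b)

  Adj-sym : ∀ {b v j} → Adj b v j → Adj b j v
  Adj-sym {v = v} {j} (j≢v , eq) = ≢-sym j≢v , trans (c-sym j v) eq

  deg : Bool → V → List V → ℕ
  deg b v X = length (filter (Adj? b v) X)

  -- Ordered pairs are counted: for duplicate-free `X`, `e b X X` is twice the number of edges of
  -- colour `b` inside `X`.
  e : Bool → List V → List V → ℕ
  e b X Y = sum (map (λ x → deg b x Y) X)

  Clique : Bool → List V → Set
  Clique b = AllPairs (Adj b)

  HasClique : Bool → ℕ → List V → Set
  HasClique b m X = ∃[ P ] (P ⊆ X × Clique b P × length P ≡ m)

  deg-yes : ∀ {b v x} X → Adj b v x → deg b v (x ∷ X) ≡ suc (deg b v X)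
  deg-yes {b} {v} X a = cong length (filter-accept (Adj? b v) {xs = X} a)

  deg-no : ∀ {b v x} X → ¬ Adj b v x → deg b v (x ∷ X) ≡ deg b v X
  deg-no {b} {v} X a = cong length (filter-reject (Adj? b v) {xs = X} a)

  deg-++ : ∀ b v X Y → deg b v (X ++ Y) ≡ deg b v X + deg b v Y
  deg-++ b v X Y = trans (cong length (filter-++ (Adj? b v) X Y)) (length-++ (filter (Adj? b v) X))

  deg-↭ : ∀ b v {X Y} → X ↭ Y → deg b v X ≡ deg b v Y
  deg-↭ b v π = ↭-length (filter-↭ (Adj? b v) π)

  deg-∷ : ∀ b v x X →
    (Adj b v x × deg b v (x ∷ X) ≡ suc (deg b v X)) ⊎ (¬ Adj b v x × deg b v (x ∷ X) ≡ deg b v X)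
  deg-∷ b v x X = case Adj? b v x of λ where
    (yes a) → inj₁ (a , deg-yes X a)
    (no ¬a) → inj₂ (¬a , deg-no X ¬a)

  deg-total : ∀ b v Y → deg b v Y + deg (not b) v Y ≤ length Y
  deg-total b v [] = z≤n
  deg-total b v (y ∷ Y) with deg-∷ b v y Y | deg-∷ (not b) v y Y
  ... | inj₁ ((_ , p) , _) | inj₁ ((_ , r) , _) = contradiction r (not-¬ p)
  ... | inj₁ (_ , p) | inj₂ (_ , r) rewrite p | r = s≤s (deg-total b v Y)
  ... | inj₂ (_ , p) | inj₁ (_ , r) rewrite p | r | +-suc (deg b v Y) (deg (not b) v Y) = s≤s (deg-total b v Y)
  ... | inj₂ (_ , p) | inj₂ (_ , r) rewrite p | r = m≤n⇒m≤1+n (deg-total b v Y)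

  deg-total-∷ : ∀ b {v y} Y → v ≢ y →
    suc (deg b v Y + deg (not b) v Y) ≤ deg b v (y ∷ Y) + deg (not b) v (y ∷ Y)
  deg-total-∷ b {v} {y} Y v≢y with deg-∷ b v y Y | deg-∷ (not b) v y Y
  ... | inj₁ (_ , p) | inj₁ (_ , r) rewrite p | r = s≤s (+-monoʳ-≤ _ (n≤1+n _))
  ... | inj₁ (_ , p) | inj₂ (_ , r) rewrite p | r = ≤-refl
  ... | inj₂ (_ , p) | inj₁ (_ , r) rewrite p | r = ≤-reflexive (sym (+-suc _ _))
  ... | inj₂ (¬p , _) | inj₂ (¬r , _) with c v y ≟ᵇ b
  ...   | yes q = contradiction (≢-sym v≢y , q) ¬p
  ...   | no q = contradiction (≢-sym v≢y , ¬-not q) ¬r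

  deg-total-≢ : ∀ b {v Y} → All (v ≢_) Y → length Y ≤ deg b v Y + deg (not b) v Y
  deg-total-≢ b [] = z≤n
  deg-total-≢ b {v} {y ∷ Y} (v≢y ∷ ps) = ≤-trans (s≤s (deg-total-≢ b ps)) (deg-total-∷ b Y v≢y)

  -- The vertex `v` may itself occur in `Y`, but only once, and it is not adjacent to itself: hence
  -- the `suc`.
  deg-total-Unique : ∀ b v {Y} → Unique Y → length Y ≤ suc (deg b v Y + deg (not b) v Y)
  deg-total-Unique b v [] = z≤n
  deg-total-Unique b v {y ∷ Y} (p ∷ u) with v ≟ y
  ... | no v≢y = s≤s (≤-trans (deg-total-Unique b v u) (deg-total-∷ b Y v≢y))
  ... | yes refl = s≤s (≤-trans (deg-total-≢ b p)
    (≤-reflexive (sym (cong₂ _+_ (deg-no {b} Y irrefl) (deg-no {not b} Y irrefl)))))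
    where
    irrefl : ∀ {b} → ¬ Adj b v v
    irrefl (v≢v , _) = v≢v refl

  e-++ˡ : ∀ b X X₁ Y → e b (X ++ X₁) Y ≡ e b X Y + e b X₁ Y
  e-++ˡ b X X₁ Y = trans (cong sum (map-++ (λ x → deg b x Y) X X₁)) (sum-++ (map _ X) (map _ X₁))

  e-++ʳ : ∀ b X Y Z → e b X (Y ++ Z) ≡ e b X Y + e b X Z
  e-++ʳ b [] Y Z = refl
  e-++ʳ b (x ∷ X) Y Z = trans (cong₂ _+_ (deg-++ b x Y Z) (e-++ʳ b X Y Z))
    (+-exchange (deg b x Y) (deg b x Z) (e b X Y) (e b X Z))

  e-↭ˡ : ∀ b {X X₁} Y → X ↭ X₁ → e b X Y ≡ e b X₁ Y
  e-↭ˡ b Y π = sum-↭ (map⁺ (λ x → deg b x Y) π)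

  e-↭ʳ : ∀ b X {Y Y₁} → Y ↭ Y₁ → e b X Y ≡ e b X Y₁
  e-↭ʳ b [] π = refl
  e-↭ʳ b (x ∷ X) π = cong₂ _+_ (deg-↭ b x π) (e-↭ʳ b X π)

  e-[]ʳ : ∀ b X → e b X [] ≡ 0
  e-[]ʳ b [] = refl
  e-[]ʳ b (x ∷ X) = e-[]ʳ b X

  e-∷ʳ : ∀ b y X Y → e b X (y ∷ Y) ≡ deg b y X + e b X Y
  e-∷ʳ b y [] Y = refl
  e-∷ʳ b y (x ∷ X) Y = trans (cong₂ _+_ (deg-++ b x (y ∷ []) Y) (e-∷ʳ b y X Y))
    (trans (+-exchange (deg b x (y ∷ [])) (deg b x Y) (deg b y X) (e b X Y))
      (cong (_+ (deg b x Y + e b X Y)) sym-step))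
    where
    sym-step : deg b x (y ∷ []) + deg b y X ≡ deg b y (x ∷ X)
    sym-step with deg-∷ b y x X
    ... | inj₁ (a , p) = trans (cong (_+ deg b y X) (deg-yes [] (Adj-sym a))) (sym p)
    ... | inj₂ (¬a , p) = trans (cong (_+ deg b y X) (deg-no [] (¬a ∘ Adj-sym))) (sym p)

  e-sym : ∀ b X Y → e b X Y ≡ e b Y X
  e-sym b [] Y = sym (e-[]ʳ b Y)
  e-sym b (x ∷ X) Y = trans (cong (deg b x Y +_) (e-sym b X Y)) (sym (e-∷ʳ b x Y X))

  e-≤ : ∀ b X Y → e b X Y ≤ length X * length Y
  e-≤ b [] Y = z≤n
  e-≤ b (x ∷ X) Y = +-mono-≤ (length-filter (Adj? b x) Y) (e-≤ b X Y)

  e-total : ∀ b X Y → e b X Y + e (not b) X Y ≤ length X * length Y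
  e-total b [] Y = z≤n
  e-total b (x ∷ X) Y = ≤-trans
    (≤-reflexive (+-exchange (deg b x Y) (e b X Y) (deg (not b) x Y) (e (not b) X Y)))
    (+-mono-≤ (deg-total b x Y) (e-total b X Y))

  e-total-Unique : ∀ b X {Y} → Unique Y → length X * length Y ≤ length X + (e b X Y + e (not b) X Y)
  e-total-Unique b [] u = z≤n
  e-total-Unique b (x ∷ X) {Y} u = ≤-trans
    (+-mono-≤ (deg-total-Unique b x u) (e-total-Unique b X u))
    (≤-reflexive (cong suc (lem (deg b x Y) (e b X Y) (deg (not b) x Y) (e (not b) X Y) (length X))))
    where
    lem : ∀ p q r s l → p + r + (l + (q + s)) ≡ l + (p + q + (r + s))
    lem = solve-∀

  e-≥ : ∀ b X Y {d m} → (∀ x → d ≤ m * deg b x Y) → d * length X ≤ m * e b X Y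
  e-≥ b [] Y {d} {m} _ = ≤-reflexive (trans (*-zeroʳ d) (sym (*-zeroʳ m)))
  e-≥ b (x ∷ X) Y {d} {m} p = begin
    d * suc (length X) ≡⟨ *-suc d (length X) ⟩
    d + d * length X ≤⟨ +-mono-≤ (p x) (e-≥ b X Y {d} {m} p) ⟩
    m * deg b x Y + m * e b X Y ≡⟨ *-distribˡ-+ m (deg b x Y) (e b X Y) ⟨
    m * e b (x ∷ X) Y ∎
    where open ≤-Reasoning

  -- Cliques, Ramsey's theorem and common neighbourhoods.

  HasClique-cons : ∀ {b m x X} → HasClique b m (filter (Adj? b x) X) → HasClique b (suc m) (x ∷ X)
  HasClique-cons {b} {x = x} {X} (P , P⊆ , cl , refl) =
    x ∷ P , refl ∷ ⊆-trans P⊆ (filter-⊆ (Adj? b x) X) ,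
    All-resp-⊆ P⊆ (all-filter (Adj? b x) X) ∷ cl , refl

  HasClique-anti : ∀ {b m₁ m₂ X} → m₁ ≤ m₂ → HasClique b m₂ X → HasClique b m₁ X
  HasClique-anti {m₁ = m₁} m₁≤m₂ (P , P⊆ , cl , refl) =
    take m₁ P , ⊆-trans (take-⊆ m₁ P) P⊆ , AllPairs-resp-⊆ (take-⊆ m₁ P) cl ,
    trans (length-take m₁ P) (m≤n⇒m⊓n≡m m₁≤m₂)

  HasClique-⊆ : ∀ {b m X Y} → X ⊆ Y → HasClique b m X → HasClique b m Y
  HasClique-⊆ s (P , P⊆ , r) = P , ⊆-trans P⊆ s , r

  -- The Erdős-Szekeres induction: by Pascal's rule, one of the two colour neighbourhoods of the
  -- first vertex is large enough for a smaller instance.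
  ramsey : ∀ b p q {X} → Unique X → (p + q) C p ≤ length X → HasClique b p X ⊎ HasClique (not b) q X
  ramsey b zero q {X} u _ = inj₁ ([] , minimum X , [] , refl)
  ramsey b (suc p) zero {X} u _ = inj₂ ([] , minimum X , [] , refl)
  ramsey b (suc p) (suc q) {[]} u le =
    contradiction le (<⇒≱ (C-positive {suc p + suc q} {suc p} (m≤m+n (suc p) (suc q))))
  ramsey b (suc p) (suc q) {x ∷ X} (x∉X ∷ u) le
    with sum-≤⇒⊎ ((p + suc q) C p) ((p + suc q) C suc p)
           (≤-trans (≤-reflexive (nCk+nC[k+1]≡[n+1]C[k+1] (p + suc q) p))
             (≤-trans le (s≤s (deg-total-≢ b x∉X))))
  ... | inj₁ le₁ with ramsey b p (suc q) (AllPairs-resp-⊆ (filter-⊆ (Adj? b x) X) u) le₁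
  ...   | inj₁ h = inj₁ (HasClique-cons h)
  ...   | inj₂ h = inj₂ (HasClique-⊆ (x ∷ʳ filter-⊆ (Adj? b x) X) h)
  ramsey b (suc p) (suc q) {x ∷ X} (x∉X ∷ u) le
      | inj₂ le₂ with ramsey b (suc p) q (AllPairs-resp-⊆ (filter-⊆ (Adj? (not b) x) X) u)
                        (≤-trans (≤-reflexive (cong (_C suc p) (sym (+-suc p q)))) le₂)
  ...   | inj₁ h = inj₁ (HasClique-⊆ (x ∷ʳ filter-⊆ (Adj? (not b) x) X) h)
  ...   | inj₂ h = inj₂ (HasClique-cons h)

  Complete : Bool → List V → List V → Set
  Complete b P W = All (λ x → All (Adj b x) W) P

  -- Pigeonhole over the `m`-subsets of `S`, by recursion on `S`: Pascal's rule splits these subsets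
  -- by whether they contain the first vertex `u`, and `X` splits into neighbours and non-neighbours
  -- of `u`.
  common-neighbourhood : ∀ b m S X L → All (λ x → m ≤ deg b x S) X → (length S C m) * L < length X →
    ∃[ P ] ∃[ W ] (P ⊆ S × length P ≡ m × W ⊆ X × L < length W × Complete b P W)
  common-neighbourhood b zero S X L _ lt =
    [] , X , minimum S , refl , ⊆-refl ,
    ≤-<-trans (≤-reflexive (sym (trans (cong (_* L) (nC0≡1 (length S))) (+-identityʳ L)))) lt , []
  common-neighbourhood b (suc m) [] (x ∷ X) L (() ∷ _) lt
  common-neighbourhood b (suc m) (u ∷ S) X L ps lt
    with sum-<⇒⊎ ((length S C m) * L) ((length S C suc m) * L)
           (subst₂ _<_
             (trans (cong (_* L) (sym (nCk+nC[k+1]≡[n+1]C[k+1] (length S) m))) (*-distribʳ-+ L (length S C m) _))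
             (length-filter-∁ (Adj? b u) X) lt)
  ... | inj₁ lt₁
    -- Here `u` joins `P`: its neighbours in `X` still have `m` neighbours in the rest of `S`. In
    -- the other case `u` is dropped, and the non-neighbours lose nothing.
    with common-neighbourhood b m S (filter (Adj? b u) X) L
           (All.zipWith (λ { (a , p) → ≤-pred (subst (suc m ≤_) (deg-yes S (Adj-sym a)) p) })
             (all-filter (Adj? b u) X , All-resp-⊆ (filter-⊆ (Adj? b u) X) ps)) lt₁
  ...   | P , W , P⊆ , len , W⊆ , L< , com =
    u ∷ P , W , refl ∷ P⊆ , cong suc len , ⊆-trans W⊆ (filter-⊆ (Adj? b u) X) , L< ,
    All-resp-⊆ W⊆ (all-filter (Adj? b u) X) ∷ com
  common-neighbourhood b (suc m) (u ∷ S) X L ps lt | inj₂ lt₂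
    with common-neighbourhood b (suc m) S (filter (∁? (Adj? b u)) X) L
           (All.zipWith (λ { (a , p) → subst (suc m ≤_) (deg-no S (a ∘ Adj-sym)) p })
             (all-filter (∁? (Adj? b u)) X , All-resp-⊆ (filter-⊆ (∁? (Adj? b u)) X) ps)) lt₂
  ...   | P , W , P⊆ , len , W⊆ , L< , com =
    P , W , u ∷ʳ P⊆ , len , ⊆-trans W⊆ (filter-⊆ (∁? (Adj? b u)) X) , L< , com

-- The final count for a nearly bipartite colouring.

4mn≤[m+n]² : ∀ m n → 4 * (m * n) ≤ (m + n) * (m + n)
4mn≤[m+n]² m n with ≤-total m n
... | inj₁ m≤n with m≤n⇒∃[o]m+o≡n m≤n
...   | o , refl = ≤-trans (m≤m+n (4 * (m * (m + o))) (o * o)) (≤-reflexive (identity m o))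
  where
  identity : ∀ m o → 4 * (m * (m + o)) + o * o ≡ (m + (m + o)) * (m + (m + o))
  identity = solve-∀
4mn≤[m+n]² m n | inj₂ n≤m with m≤n⇒∃[o]m+o≡n n≤m
... | o , refl = ≤-trans (m≤m+n (4 * ((n + o) * n)) (o * o)) (≤-reflexive (identity n o))
  where
  identity : ∀ n o → 4 * ((n + o) * n) + o * o ≡ (n + o + n) * (n + o + n)
  identity = solve-∀

-- The `eA` numbers count blue edges leaving `A`, the `eB` numbers red edges leaving `B`, and
-- `n / h` is the degree excess over `n / 4`. The pairs across are shared by the two colours, so
-- they give at most `α * β`, a quarter of the square of `α + β`; the sparse insides and the small
-- remainder cannot supply the excess.
bipartite-count : ∀ h α β z {n eAA eAB eAZ eBA eBB eBZ} → n ≡ α + β + z → suc h * z < n →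
  (h + 4) * n * α ≤ 4 * h * (eAA + eAB + eAZ) → (h + 4) * n * β ≤ 4 * h * (eBA + eBB + eBZ) →
  4 * h * eAA ≤ α * α → 4 * h * eBB ≤ β * β → eAB + eBA ≤ α * β →
  eAZ ≤ α * z → eBZ ≤ β * z → ⊥
bipartite-count h α β z {_} {eAA} {eAB} {eAZ} {eBA} {eBB} {eBZ} refl small degA degB AA BB AB AZ BZ =
  <-irrefl refl (begin-strict
    T <⟨ m<n+m T (≤-trans (s≤s z≤n) (≤-trans hz<σ (m≤n*m σ 3))) ⟩
    3 * σ + T ≡⟨ identity₁ h z σ ⟩
    -- The strict bound `h * z < σ` is used in the form `suc (h * z) ≤ σ`; the spare `3 * σ` above
    -- is what makes the whole chain strict.
    3 * suc (h * z) * σ + (suc h * (σ * σ) + h * z * σ) ≤⟨ +-monoˡ-≤ _ (*-monoˡ-≤ σ (*-monoʳ-≤ 3 hz<σ)) ⟩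
    3 * σ * σ + (suc h * (σ * σ) + h * z * σ) ≤⟨ m≤m+n _ (4 * z * σ) ⟩
    3 * σ * σ + (suc h * (σ * σ) + h * z * σ) + 4 * z * σ ≡⟨ identity₂ h α β z ⟩
    (h + 4) * (σ + z) * α + (h + 4) * (σ + z) * β ≤⟨ +-mono-≤ degA degB ⟩
    4 * h * (eAA + eAB + eAZ) + 4 * h * (eBA + eBB + eBZ) ≡⟨ identity₃ h eAA eAB eAZ eBA eBB eBZ ⟩
    4 * h * eAA + 4 * h * eBB + 4 * h * (eAB + eBA) + 4 * h * (eAZ + eBZ)
      ≤⟨ +-mono-≤ (+-mono-≤ (+-mono-≤ AA BB) (*-monoʳ-≤ (4 * h) AB)) (*-monoʳ-≤ (4 * h) (+-mono-≤ AZ BZ)) ⟩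
    α * α + β * β + 4 * h * (α * β) + 4 * h * (α * z + β * z) ≡⟨ identity₄ h α β z ⟩
    (α * α + β * β) + h * (4 * (α * β)) + 4 * h * z * σ
      ≤⟨ +-monoˡ-≤ (4 * h * z * σ) (+-mono-≤ (m≤m+n (α * α + β * β) (2 * (α * β))) (*-monoʳ-≤ h (4mn≤[m+n]² α β))) ⟩
    (α * α + β * β + 2 * (α * β)) + h * (σ * σ) + 4 * h * z * σ ≡⟨ identity₅ h α β z ⟩
    T ∎)
  where
  open ≤-Reasoning
  σ = α + β
  T = suc h * (σ * σ) + 4 * h * z * σ
  hz<σ : h * z < σ
  hz<σ = +-cancelˡ-< z (h * z) σ (<-≤-trans small (≤-reflexive (+-comm σ z)))
  identity₁ : ∀ h z σ → 3 * σ + (suc h * (σ * σ) + 4 * h * z * σ) ≡ 3 * suc (h * z) * σ + (suc h * (σ * σ) + h * z * σ)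
  identity₁ = solve-∀
  identity₂ : ∀ h α β z → 3 * (α + β) * (α + β) + (suc h * ((α + β) * (α + β)) + h * z * (α + β)) + 4 * z * (α + β)
    ≡ (h + 4) * (α + β + z) * α + (h + 4) * (α + β + z) * β
  identity₂ = solve-∀
  identity₃ : ∀ h a b c d e f → 4 * h * (a + b + c) + 4 * h * (d + e + f) ≡ 4 * h * a + 4 * h * e + 4 * h * (b + d) + 4 * h * (c + f)
  identity₃ = solve-∀
  identity₄ : ∀ h α β z → α * α + β * β + 4 * h * (α * β) + 4 * h * (α * z + β * z) ≡ (α * α + β * β) + h * (4 * (α * β)) + 4 * h * z * (α + β)
  identity₄ = solve-∀
  identity₅ : ∀ h α β z → (α * α + β * β + 2 * (α * β)) + h * ((α + β) * (α + β)) + 4 * h * z * (α + β) ≡ suc h * ((α + β) * (α + β)) + 4 * h * z * (α + β)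
  identity₅ = solve-∀

-- Edge counts in the absence of a pattern.

module NoPattern {n : ℕ} (c : Colouring n) (c-sym : IsSymmetric c) (t : ℕ) (1≤t : 1 ≤ t)
  (no-pattern : ∀ b {P Q} → length P ≡ t → length Q ≡ t →
    Edges.Clique c c-sym (not b) P → Edges.Clique c c-sym (not b) Q → Edges.Complete c c-sym b P Q → ⊥)
  where

  open Edges c c-sym

  instance
    t≢0 : NonZero t
    t≢0 = >-nonZero 1≤t

  -- The double negation spares a decision procedure for cliques: every use of
  -- richness proves a stable inequality or ⊥.
  Rich : Bool → ℕ → ℕ → List V → Set
  Rich b m L X = ∀ {W} → W ⊆ X → L ≤ length W → ¬ ¬ HasClique b m W

  Rich-⊆ : ∀ {b m L X Y} → X ⊆ Y → Rich b m L Y → Rich b m L X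
  Rich-⊆ X⊆Y rich W⊆X = rich (⊆-trans W⊆X X⊆Y)

  Rich-anti : ∀ {b m₁ m₂ L X} → m₁ ≤ m₂ → Rich b m₂ L X → Rich b m₁ L X
  Rich-anti m₁≤m₂ rich W⊆X L≤W ¬h = rich W⊆X L≤W (¬h ∘ HasClique-anti m₁≤m₂)

  -- The two sides of the forbidden pattern would be a `t`-subset `P` of `S` and a clique `Q` found
  -- in its common neighbourhood `W`.
  exceptional : ∀ b {S Y L} → Clique (not b) S → Rich (not b) t L Y →
    length (filter (λ y → t ≤? deg b y S) Y) ≤ (length S C t) * L
  exceptional b {S} {Y} {L} cl rich = ≮⇒≥ λ lt →
    case common-neighbourhood b t S (filter Ex? Y) L (all-filter Ex? Y) lt of λ where
      (P , W , P⊆S , len , W⊆ , L<W , com) →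
        rich (⊆-trans W⊆ (filter-⊆ Ex? Y)) (<⇒≤ L<W) λ where
          (Q , Q⊆W , clQ , lenQ) →
            no-pattern b len lenQ (AllPairs-resp-⊆ P⊆S cl) clQ (All.map (All-resp-⊆ Q⊆W) com)
    where
    Ex? = λ y → t ≤? deg b y S

  -- A vertex of `Y` sends at most `t` edges to `S`, unless it is exceptional, and then at most
  -- `length S`.
  e-split : ∀ b Y S → e b Y S ≤ t * length Y + length S * length (filter (λ y → t ≤? deg b y S) Y)
  e-split b [] S = z≤n
  e-split b (y ∷ Y) S = case t ≤? deg b y S of λ where
      (yes p) → begin
        deg b y S + e b Y S ≤⟨ +-mono-≤ (length-filter (Adj? b y) S) (e-split b Y S) ⟩
        s + (t * length Y + s * ex Y) ≤⟨ m≤n+m _ t ⟩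
        t + (s + (t * length Y + s * ex Y)) ≡⟨ identity t s (length Y) (ex Y) ⟩
        t * suc (length Y) + s * suc (ex Y) ≡⟨ cong (λ x → t * suc (length Y) + s * length x) (filter-accept Ex? {xs = Y} p) ⟨
        t * suc (length Y) + s * ex (y ∷ Y) ∎
      (no ¬p) → begin
        deg b y S + e b Y S ≤⟨ +-mono-≤ (≰⇒≥ ¬p) (e-split b Y S) ⟩
        t + (t * length Y + s * ex Y) ≡⟨ +-assoc t _ _ ⟨
        t + t * length Y + s * ex Y ≡⟨ cong (_+ s * ex Y) (*-suc t (length Y)) ⟨
        t * suc (length Y) + s * ex Y ≡⟨ cong (λ x → t * suc (length Y) + s * length x) (filter-reject Ex? {xs = Y} ¬p) ⟨
        t * suc (length Y) + s * ex (y ∷ Y) ∎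
    where
    open ≤-Reasoning
    s = length S
    Ex? = λ y → t ≤? deg b y S
    ex : List V → ℕ
    ex Y = length (filter Ex? Y)
    identity : ∀ t s l x → t + (s + (t * l + s * x)) ≡ t * suc l + s * suc x
    identity = solve-∀

  clique-edges : ∀ b {S Y L} → Clique (not b) S → Rich (not b) t L Y →
    e b S Y ≤ t * length Y + length S * ((length S C t) * L)
  clique-edges b {S} {Y} cl rich = ≤-trans (≤-reflexive (e-sym b S Y))
    (≤-trans (e-split b Y S) (+-monoʳ-≤ (t * length Y) (*-monoʳ-≤ (length S) (exceptional b cl rich))))

  -- Peels s-cliques off X until fewer than L vertices are left.
  rich-edges : ∀ b s {L L₁ Y} → 1 ≤ s → Rich (not b) t L₁ Y → ∀ k {X} → length X ≤ k → Rich (not b) s L X →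
    s * e b X Y ≤ length X * (s * ((s C t) * L₁) + t * length Y) + s * (L * length Y)
  rich-edges b s 1≤s richY k {[]} _ richX = ≤-trans (≤-reflexive (*-zeroʳ s)) z≤n
  rich-edges b s {L} {L₁} {Y} 1≤s richY (suc k) {X@(_ ∷ _)} X≤k richX with L ≤? length X
  ... | no L≰X = ≤-trans
    (*-monoʳ-≤ s (≤-trans (e-≤ b X Y) (*-monoˡ-≤ (length Y) (≰⇒≥ L≰X))))
    (m≤n+m _ _)
  ... | yes L≤X = decidable-stable (_ ≤? _) λ ¬goal → richX ⊆-refl L≤X λ where
      (S , S⊆X , cl , |S|≡s) → ¬goal (step cl |S|≡s (⊆-complement S⊆X))
    where
    step : ∀ {S} → Clique (not b) S → length S ≡ s → ∃[ X₁ ] (X₁ ⊆ X × X ↭ S ++ X₁) →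
      s * e b X Y ≤ length X * (s * ((s C t) * L₁) + t * length Y) + s * (L * length Y)
    step {S} cl refl (X₁ , X₁⊆X , π) = begin
      s * e b X Y ≡⟨ cong (s *_) (trans (e-↭ˡ b Y π) (e-++ˡ b S X₁ Y)) ⟩
      s * (e b S Y + e b X₁ Y) ≡⟨ *-distribˡ-+ s (e b S Y) (e b X₁ Y) ⟩
      s * e b S Y + s * e b X₁ Y
        ≤⟨ +-mono-≤ (*-monoʳ-≤ s (clique-edges b cl richY))
             (rich-edges b s 1≤s richY k X₁≤k (Rich-⊆ X₁⊆X richX)) ⟩
      -- The factor `s` clears a denominator: the clique `S` costs `t * y / s + E` edges per vertex,
      -- so larger cliques give sparser bounds.
      s * (t * y + s * E) + (x₁ * (s * E + t * y) + s * (L * y))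
        ≡⟨ identity s t y E x₁ (s * (L * y)) ⟩
      (s + x₁) * (s * E + t * y) + s * (L * y)
        ≡⟨ cong (λ x → x * (s * E + t * y) + s * (L * y)) |X| ⟨
      length X * (s * E + t * y) + s * (L * y) ∎
      where
      open ≤-Reasoning
      y = length Y
      x₁ = length X₁
      E = (length S C t) * L₁
      |X| : length X ≡ length S + x₁
      |X| = trans (↭-length π) (length-++ S)
      X₁≤k : x₁ ≤ k
      X₁≤k = ≤-pred (≤-trans (+-monoˡ-≤ x₁ 1≤s) (≤-trans (≤-reflexive (sym |X|)) X≤k))
      identity : ∀ s t y E x r → s * (t * y + s * E) + (x * (s * E + t * y) + r) ≡ (s + x) * (s * E + t * y) + r
      identity = solve-∀

  -- No large set is rich in both colours.

  threshold : ℕ → ℕ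
  threshold L = 3 + (4 * (((4 * t) C t) * L) + 4 * L)

  -- With cliques of size `4 * t`, each colour takes at most a quarter of the ordered pairs, up to
  -- terms linear in `length X`. Together they take about half, yet they must cover everything off
  -- the diagonal. This forces `x ≤ 2 + 4 * E + 4 * L`, one less than `threshold L`.
  not-both-rich : ∀ {L X} → Unique X → threshold L ≤ length X → (∀ b → Rich b (4 * t) L X) → ⊥
  not-both-rich {L} {X} u X≥ rich = <-irrefl refl (begin-strict
      4 * x <⟨ m<n+m (4 * x) {2} (s≤s z≤n) ⟩
      2 + 4 * x ≤⟨ +-monoʳ-≤ 2 4x≤ ⟩
      2 + (4 + 8 * E + 8 * L + 2 * x) ≡⟨ identity₃ E L x ⟩
      2 * (3 + (4 * E + 4 * L)) + 2 * x ≤⟨ +-monoˡ-≤ (2 * x) (*-monoʳ-≤ 2 X≥) ⟩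
      2 * x + 2 * x ≡⟨ identity₄ x ⟩
      4 * x ∎)
    where
    open ≤-Reasoning
    x = length X
    E = ((4 * t) C t) * L
    t≤4t : t ≤ 4 * t
    t≤4t = m≤n*m t 4
    instance
      x≢0 : NonZero x
      x≢0 = >-nonZero (≤-trans (s≤s z≤n) X≥)
    identity₁ : ∀ t E x L → x * (4 * t * E + t * x) + 4 * t * (L * x) ≡ t * (x * (4 * E + x) + 4 * (L * x))
    identity₁ = solve-∀
    identity₂ : ∀ x E L → 4 * x + ((x * (4 * E + x) + 4 * (L * x)) + (x * (4 * E + x) + 4 * (L * x))) ≡ x * (4 + 8 * E + 8 * L + 2 * x)
    identity₂ = solve-∀
    identity₃ : ∀ E L x → 2 + (4 + 8 * E + 8 * L + 2 * x) ≡ 2 * (3 + (4 * E + 4 * L)) + 2 * x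
    identity₃ = solve-∀
    identity₄ : ∀ x → 2 * x + 2 * x ≡ 4 * x
    identity₄ = solve-∀
    identity₅ : ∀ t m → t * (4 * m) ≡ 4 * t * m
    identity₅ = solve-∀
    identity₆ : ∀ x p q → 4 * (x + (p + q)) ≡ 4 * x + (4 * p + 4 * q)
    identity₆ = solve-∀
    identity₇ : ∀ x → x * (4 * x) ≡ 4 * (x * x)
    identity₇ = solve-∀
    sparse : ∀ b → 4 * e b X X ≤ x * (4 * E + x) + 4 * (L * x)
    sparse b = *-cancelˡ-≤ t (begin
      t * (4 * e b X X) ≡⟨ identity₅ t (e b X X) ⟩
      4 * t * e b X X
        ≤⟨ rich-edges b (4 * t) (≤-trans 1≤t t≤4t) (Rich-anti t≤4t (rich (not b))) x ≤-refl (rich (not b)) ⟩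
      x * (4 * t * E + t * x) + 4 * t * (L * x) ≡⟨ identity₁ t E x L ⟩
      t * (x * (4 * E + x) + 4 * (L * x)) ∎)
    4x≤ : 4 * x ≤ 4 + 8 * E + 8 * L + 2 * x
    4x≤ = *-cancelˡ-≤ x (begin
      x * (4 * x) ≡⟨ identity₇ x ⟩
      4 * (x * x) ≤⟨ *-monoʳ-≤ 4 (e-total-Unique true X u) ⟩
      4 * (x + (e true X X + e false X X)) ≡⟨ identity₆ x (e true X X) (e false X X) ⟩
      4 * x + (4 * e true X X + 4 * e false X X) ≤⟨ +-monoʳ-≤ (4 * x) (+-mono-≤ (sparse true) (sparse false)) ⟩
      4 * x + ((x * (4 * E + x) + 4 * (L * x)) + (x * (4 * E + x) + 4 * (L * x))) ≡⟨ identity₂ x E L ⟩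
      x * (4 + 8 * E + 8 * L + 2 * x) ∎)

  -- Blocks, their sparse colour, and the partition into two unions of blocks.

  module Blocks (K ℓ L : ℕ) (1≤K : 1 ≤ K) (1≤L : 1 ≤ L)
    (ramsey-≤ : (4 * t + K * t) C (4 * t) ≤ ℓ)
    (exceptional-≤ : K * (((K * t) C t) * ℓ) ≤ L) (remainder-≤ : K * ℓ ≤ L) where

    Block : Bool → List V → Set
    Block b X = Unique X × length X ≡ L × ¬ HasClique b (4 * t) X

    block-rich : ∀ {b X} → Block b X → Rich (not b) (K * t) ℓ X
    block-rich {b} (u , _ , free) {W} W⊆X ℓ≤W ¬h
      with ramsey b (4 * t) (K * t) (AllPairs-resp-⊆ W⊆X u) (≤-trans ramsey-≤ ℓ≤W)
    ... | inj₁ h = free (HasClique-⊆ W⊆X h)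
    ... | inj₂ h = ¬h h

    -- Cliques of size `K * t` make the main term `x * y / K`. The two lower bounds on `L` keep the
    -- exceptional vertices and the unpeeled remainder below `x * y / K` each, which gives the
    -- factor 3.
    block-edges : ∀ {b X Y} → Block b X → Block b Y → K * e b X Y ≤ 3 * (length X * length Y)
    block-edges {b} {X} {Y} BX@(_ , refl , _) BY@(_ , |Y|≡ , _) = *-cancelˡ-≤ t (begin
        t * (K * e b X Y) ≡⟨ identity₁ t K (e b X Y) ⟩
        K * t * e b X Y
          ≤⟨ rich-edges b (K * t) (≤-trans 1≤t t≤Kt) (Rich-anti t≤Kt (block-rich BY)) x ≤-refl (block-rich BX) ⟩
        x * (K * t * E + t * y) + K * t * (ℓ * y) ≡⟨ identity₂ t K E ℓ x y ⟩
        t * (x * (K * E + y) + (K * ℓ) * y)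
          ≤⟨ *-monoʳ-≤ t (+-mono-≤ (*-monoʳ-≤ x (+-monoˡ-≤ y (≤-trans exceptional-≤ (≤-reflexive (sym |Y|≡)))))
               (*-monoˡ-≤ y remainder-≤)) ⟩
        t * (x * (y + y) + x * y) ≡⟨ identity₃ t x y ⟩
        t * (3 * (x * y)) ∎)
      where
      open ≤-Reasoning
      x = length X
      y = length Y
      E = ((K * t) C t) * ℓ
      t≤Kt : t ≤ K * t
      t≤Kt = m≤n*m t K {{>-nonZero 1≤K}}
      identity₁ : ∀ t K m → t * (K * m) ≡ K * t * m
      identity₁ = solve-∀
      identity₂ : ∀ t K E l x y → x * (K * t * E + t * y) + K * t * (l * y) ≡ t * (x * (K * E + y) + (K * l) * y)
      identity₂ = solve-∀
      identity₃ : ∀ t x y → t * (x * (y + y) + x * y) ≡ t * (3 * (x * y))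
      identity₃ = solve-∀

    block-concat-edges : ∀ {b X Bs} → Block b X → All (Block b) Bs →
      K * e b X (concat Bs) ≤ 3 * (length X * length (concat Bs))
    block-concat-edges {b} {X} {[]} _ [] =
      ≤-trans (≤-reflexive (trans (cong (K *_) (e-[]ʳ b X)) (*-zeroʳ K))) z≤n
    block-concat-edges {b} {X} {Y ∷ Bs} BX (BY ∷ BBs) = begin
      K * e b X (Y ++ concat Bs) ≡⟨ cong (K *_) (e-++ʳ b X Y (concat Bs)) ⟩
      K * (e b X Y + e b X (concat Bs)) ≡⟨ *-distribˡ-+ K (e b X Y) _ ⟩
      K * e b X Y + K * e b X (concat Bs) ≤⟨ +-mono-≤ (block-edges BX BY) (block-concat-edges BX BBs) ⟩
      3 * (length X * length Y) + 3 * (length X * length (concat Bs)) ≡⟨ identity (length X) (length Y) _ ⟩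
      3 * (length X * (length Y + length (concat Bs))) ≡⟨ cong (λ l → 3 * (length X * l)) (length-++ Y) ⟨
      3 * (length X * length (Y ++ concat Bs)) ∎
      where
      open ≤-Reasoning
      identity : ∀ x y z → 3 * (x * y) + 3 * (x * z) ≡ 3 * (x * (y + z))
      identity = solve-∀

    -- The two families may coincide, which is how the edges inside one union of blocks get bounded.
    concat-edges : ∀ {b As Bs} → All (Block b) As → All (Block b) Bs →
      K * e b (concat As) (concat Bs) ≤ 3 * (length (concat As) * length (concat Bs))
    concat-edges [] _ = ≤-trans (≤-reflexive (*-zeroʳ K)) z≤n
    concat-edges {b} {X ∷ As} {Bs} (BX ∷ BAs) BBs = begin
      K * e b (X ++ concat As) Y ≡⟨ cong (K *_) (e-++ˡ b X (concat As) Y) ⟩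
      K * (e b X Y + e b (concat As) Y) ≡⟨ *-distribˡ-+ K (e b X Y) _ ⟩
      K * e b X Y + K * e b (concat As) Y ≤⟨ +-mono-≤ (block-concat-edges BX BBs) (concat-edges BAs BBs) ⟩
      3 * (length X * length Y) + 3 * (length (concat As) * length Y) ≡⟨ identity (length X) _ (length Y) ⟩
      3 * ((length X + length (concat As)) * length Y) ≡⟨ cong (λ l → 3 * (l * length Y)) (length-++ X) ⟨
      3 * (length (X ++ concat As) * length Y) ∎
      where
      open ≤-Reasoning
      Y = concat Bs
      identity : ∀ x y z → 3 * (x * z) + 3 * (y * z) ≡ 3 * ((x + y) * z)
      identity = solve-∀

    -- Blocks are split off greedily, with `k` bounding the recursion. A block is only known not to
    -- be absent, so the partition is handed to a continuation into `⊥` instead of being returned.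
    block-partition : ∀ k {Z} → length Z ≤ k → Unique Z →
      (∀ {As Bs R} → All (Block false) As → All (Block true) Bs → length R < threshold L →
        Z ↭ concat As ++ concat Bs ++ R → ⊥) → ⊥
    block-partition k {Z} Z≤k u kont with threshold L ≤? length Z
    ... | no Z≱ = kont [] [] (≰⇒> Z≱) ↭-refl
    block-partition zero Z≤k u kont | yes Z≥ = contradiction (≤-trans Z≥ Z≤k) λ ()
    block-partition (suc k) {Z} Z≤k u kont | yes Z≥ =
      -- A set `W` that violates richness in colour `b` supplies the next block, namely its first
      -- `L` vertices.
      not-both-rich u Z≥ λ b {W} W⊆Z L≤W free →
        let X⊆Z = ⊆-trans (take-⊆ L W) W⊆Z in
        extract b X⊆Z
          ( AllPairs-resp-⊆ X⊆Z u
          , trans (length-take L W) (m≤n⇒m⊓n≡m L≤W)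
          , free ∘ HasClique-⊆ (take-⊆ L W))
          (⊆-complement X⊆Z)
      where
      extract : ∀ b {X} → X ⊆ Z → Block b X → ∃[ Z₁ ] (Z₁ ⊆ Z × Z ↭ X ++ Z₁) → ⊥
      extract b {X} X⊆Z BX@(_ , |X|≡L , _) (Z₁ , Z₁⊆Z , π) =
        block-partition k Z₁≤k (AllPairs-resp-⊆ Z₁⊆Z u) (next b BX)
        where
        Z₁≤k : length Z₁ ≤ k
        Z₁≤k = ≤-pred (≤-trans (+-monoˡ-≤ (length Z₁) (≤-trans 1≤L (≤-reflexive (sym |X|≡L))))
          (≤-trans (≤-reflexive (sym (trans (↭-length π) (length-++ X)))) Z≤k))
        next : ∀ b → Block b X → ∀ {As Bs R} → All (Block false) As → All (Block true) Bs →
          length R < threshold L → Z₁ ↭ concat As ++ concat Bs ++ R → ⊥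
        next false BX {As} {Bs} {R} BAs BBs R< ρ = kont (BX ∷ BAs) BBs R<
          (↭-trans π (↭-trans (++⁺ˡ X ρ)
            (↭-reflexive (sym (++-assoc X (concat As) (concat Bs ++ R))))))
        next true BX {As} {Bs} {R} BAs BBs R< ρ = kont BAs (BX ∷ BBs) R<
          (↭-trans π (↭-trans (++⁺ˡ X ρ) (↭-trans (shifts X (concat As))
            (↭-reflexive (cong (concat As ++_) (sym (++-assoc X (concat Bs) R)))))))

    contradiction-from-degrees : ∀ {h} → K ≡ 12 * h → suc h * threshold L ≤ n →
      (∀ b v → (h + 4) * n ≤ 4 * h * deg b v (allFin n)) → ⊥
    contradiction-from-degrees {h} refl small min-deg =
      block-partition n (≤-reflexive |allFin|) (allFin⁺ n) count
      where
      |allFin| : length (allFin n) ≡ n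
      |allFin| = length-tabulate _

      count : ∀ {As Bs R} → All (Block false) As → All (Block true) Bs → length R < threshold L →
        allFin n ↭ concat As ++ concat Bs ++ R → ⊥
      count {As} {Bs} {R} BAs BBs R< π = bipartite-count h (length A) (length B) (length R) n≡
          (≤-<-trans (*-monoʳ-≤ (suc h) (≤-pred R<)) (<-≤-trans (*-monoʳ-< (suc h) ≤-refl) small))
          -- Each part is counted in the colour that is sparse inside it: blue at `A`, red at `B`.
          (degrees false A) (degrees true B)
          (sparse (concat-edges BAs BAs)) (sparse (concat-edges BBs BBs))
          (≤-trans (+-monoʳ-≤ (e false A B) (≤-reflexive (e-sym true B A))) (e-total false A B))
          (e-≤ false A R) (e-≤ true B R)
        where
        open ≤-Reasoning
        A = concat As
        B = concat Bs
        n≡ : n ≡ length A + length B + length R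
        n≡ = trans (sym |allFin|) (trans (↭-length π) (trans (length-++ A)
          (trans (cong (length A +_) (length-++ B)) (sym (+-assoc (length A) _ _)))))
        e-split₃ : ∀ b X → e b X (allFin n) ≡ e b X A + e b X B + e b X R
        e-split₃ b X = trans (e-↭ʳ b X π) (trans (e-++ʳ b X A (B ++ R))
          (trans (cong (e b X A +_) (e-++ʳ b X B R)) (sym (+-assoc (e b X A) _ _))))
        degrees : ∀ b X → (h + 4) * n * length X ≤ 4 * h * (e b X A + e b X B + e b X R)
        degrees b X = ≤-trans (e-≥ b X (allFin n) {m = 4 * h} (min-deg b)) (≤-reflexive (cong (4 * h *_) (e-split₃ b X)))
        -- The density `3 / K` becomes `1 / (4 * h)`; this is why `K` is `12 * h`.
        sparse : ∀ {x m} → 12 * h * m ≤ 3 * x → 4 * h * m ≤ x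
        sparse {x} {m} le = *-cancelˡ-≤ 3 (≤-trans (≤-reflexive (identity h m)) le)
          where
          identity : ∀ h m → 3 * (4 * h * m) ≡ 12 * h * m
          identity = solve-∀

-- Binomial estimates and the size of the constants.

*-interchange : ∀ a b x y → (a * b) * (x * y) ≡ (a * x) * (b * y)
*-interchange = solve-∀

^-distrib-* : ∀ m n o → (m * n) ^ o ≡ m ^ o * n ^ o
^-distrib-* m n zero = refl
^-distrib-* m n (suc o) = trans (cong (m * n *_) (^-distrib-* m n o)) (*-interchange m n (m ^ o) (n ^ o))

-- Weighting each chosen element by 1/K gives (s C r) K⁻ʳ ≤ (1 + 1/K)ˢ.
C-weighted : ∀ K s r → (s C r) * K ^ s ≤ K ^ r * suc K ^ s
C-weighted K zero zero = ≤-refl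
C-weighted K zero (suc r) = z≤n
C-weighted K (suc s) zero = ≤-trans
  (≤-reflexive (trans (cong (_* K ^ suc s) (nC0≡1 (suc s))) (+-identityʳ _)))
  (≤-trans (^-monoˡ-≤ (suc s) (n≤1+n K)) (≤-reflexive (sym (+-identityʳ _))))
C-weighted K (suc s) (suc r) = begin
  (suc s C suc r) * (K * K ^ s) ≡⟨ cong (_* (K * K ^ s)) (nCk+nC[k+1]≡[n+1]C[k+1] s r) ⟨
  ((s C r) + (s C suc r)) * (K * K ^ s) ≡⟨ identity₁ (s C r) (s C suc r) K (K ^ s) ⟩
  K * ((s C r) * K ^ s) + K * ((s C suc r) * K ^ s)
    ≤⟨ +-mono-≤ (*-monoʳ-≤ K (C-weighted K s r)) (*-monoʳ-≤ K (C-weighted K s (suc r))) ⟩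
  K * (K ^ r * suc K ^ s) + K * (K * K ^ r * suc K ^ s) ≡⟨ identity₂ K (K ^ r) (suc K ^ s) ⟩
  K * K ^ r * (suc K * suc K ^ s) ∎
  where
  open ≤-Reasoning
  identity₁ : ∀ a b K x → (a + b) * (K * x) ≡ K * (a * x) + K * (b * x)
  identity₁ = solve-∀
  identity₂ : ∀ K x y → K * (x * y) + K * (K * x * y) ≡ K * x * (suc K * y)
  identity₂ = solve-∀

-- (1 + 1/K)ʲ ≤ 1 / (1 − j/K), with d = K − j.
bernoulli : ∀ {K} j d → j + d ≡ K → suc K ^ j * d ≤ K ^ j * K
bernoulli zero d refl = ≤-refl
bernoulli {K} (suc j) d refl = begin
  suc K * suc K ^ j * d ≡⟨ identity₁ K (suc K ^ j) d ⟩
  suc K ^ j * (d + K * d) ≤⟨ *-monoʳ-≤ (suc K ^ j) (+-monoˡ-≤ (K * d) (m≤n+m d (suc j))) ⟩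
  suc K ^ j * (K + K * d) ≡⟨ identity₂ K (suc K ^ j) d ⟩
  K * (suc K ^ j * suc d) ≤⟨ *-monoʳ-≤ K (bernoulli j (suc d) (+-suc j d)) ⟩
  K * (K ^ j * K) ≡⟨ *-assoc K (K ^ j) K ⟨
  K * K ^ j * K ∎
  where
  open ≤-Reasoning
  identity₁ : ∀ K x d → suc K * x * d ≡ x * (d + K * d)
  identity₁ = solve-∀
  identity₂ : ∀ K x d → x * (K + K * d) ≡ K * (x * suc d)
  identity₂ = solve-∀

-- `C-weighted` with weight 1/(2m), where (1 + 1/(2m))^m ≤ 2 by `bernoulli`. Unlike the trivial
-- bound (m t)^r, this has no power of `t`, so the final bound stays exponential in `t`.
C-bound : ∀ m .{{_ : NonZero m}} t r → (m * t) C r ≤ (2 * m) ^ r * 2 ^ t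
C-bound m t r = *-cancelʳ-≤ _ _ (K ^ (m * t)) {{m^n≢0 K (m * t) {{m*n≢0 2 m}}}} (begin
  ((m * t) C r) * K ^ (m * t) ≤⟨ C-weighted K (m * t) r ⟩
  K ^ r * suc K ^ (m * t) ≡⟨ cong (K ^ r *_) (^-*-assoc (suc K) m t) ⟨
  K ^ r * (suc K ^ m) ^ t ≤⟨ *-monoʳ-≤ (K ^ r) (^-monoˡ-≤ t doubling) ⟩
  K ^ r * (2 * K ^ m) ^ t ≡⟨ cong (K ^ r *_) (^-distrib-* 2 (K ^ m) t) ⟩
  K ^ r * (2 ^ t * (K ^ m) ^ t) ≡⟨ *-assoc (K ^ r) (2 ^ t) _ ⟨
  K ^ r * 2 ^ t * (K ^ m) ^ t ≡⟨ cong (K ^ r * 2 ^ t *_) (^-*-assoc K m t) ⟩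
  K ^ r * 2 ^ t * K ^ (m * t) ∎)
  where
  open ≤-Reasoning
  K = 2 * m
  doubling : suc K ^ m ≤ 2 * K ^ m
  doubling = *-cancelʳ-≤ _ _ m (≤-trans
    (bernoulli m m (cong (m +_) (sym (+-identityʳ m))))
    (≤-reflexive (identity (K ^ m) m)))
    where
    identity : ∀ x m → x * (2 * m) ≡ 2 * x * m
    identity = solve-∀

-- k = ⌊1/ε⌋, and cliques of size K t are used against the degree excess n/h ≤ ε n.
module Size (k t : ℕ) (4≤k : 4 ≤ k) (1≤t : 1 ≤ t) where

  open ≤-Reasoning

  -- All sizes are compared with powers of `u`. The value of `ℓ` is the Ramsey bound that blocks
  -- need, and `L` is the sum of the two lower bounds that `Blocks` puts on it.
  u h K ℓ L : ℕ
  u = k ^ t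
  h = suc k
  K = 12 * h
  ℓ = (4 * t + K * t) C (4 * t)
  L = K * (((K * t) C t) * ℓ + ℓ)

  private instance
    k≢0 : NonZero k
    k≢0 = >-nonZero (≤-trans (s≤s z≤n) 4≤k)
    u≢0 : NonZero u
    u≢0 = m^n≢0 k t

  k≤u : k ≤ u
  k≤u = ≤-trans (≤-reflexive (sym (^-identityʳ k))) (^-monoʳ-≤ k 1≤t)

  -- Absolute constants are absorbed into powers of `k`; this is where ε < 1/4 enters the estimates.
  4^-≤ : ∀ {x} a → x ≤ 4 ^ a → x ≤ k ^ a
  4^-≤ a le = ≤-trans le (^-monoˡ-≤ a 4≤k)

  ≤u : ∀ {x} a → x ≤ k ^ a → x ≤ u ^ a
  ≤u a le = ≤-trans le (^-monoˡ-≤ a k≤u)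

  ^t-≤ : ∀ {x} a → x ≤ k ^ a → x ^ t ≤ u ^ a
  ^t-≤ {x} a le = begin
    x ^ t ≤⟨ ^-monoˡ-≤ t le ⟩
    (k ^ a) ^ t ≡⟨ ^-*-assoc k a t ⟩
    k ^ (a * t) ≡⟨ cong (k ^_) (*-comm a t) ⟩
    k ^ (t * a) ≡⟨ ^-*-assoc k t a ⟨
    u ^ a ∎

  *-^-≤ : ∀ {x y} m a b → x ≤ m ^ a → y ≤ m ^ b → x * y ≤ m ^ (a + b)
  *-^-≤ m a b p q = ≤-trans (*-mono-≤ p q) (≤-reflexive (sym (^-distribˡ-+-* m a b)))

  suc-h≤k² : suc h ≤ k ^ 2
  suc-h≤k² = begin
    2 + k ≤⟨ +-monoˡ-≤ k (≤-trans (s≤s (s≤s z≤n)) 4≤k) ⟩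
    k + k ≡⟨ cong (k +_) (+-identityʳ k) ⟨
    2 * k ≤⟨ *-monoˡ-≤ k (≤-trans (s≤s (s≤s z≤n)) 4≤k) ⟩
    k * k ≡⟨ cong (k *_) (*-identityʳ k) ⟨
    k ^ 2 ∎

  h≤k² : h ≤ k ^ 2
  h≤k² = ≤-trans (n≤1+n h) suc-h≤k²

  K≤k⁴ : K ≤ k ^ 4
  K≤k⁴ = *-^-≤ k 2 2 (4^-≤ 2 (m≤m+n 12 4)) h≤k²

  2K≤k⁵ : 2 * K ≤ k ^ 5
  2K≤k⁵ = *-^-≤ k 1 4 (4^-≤ 1 (m≤m+n 2 2)) K≤k⁴

  2[4+K]≤k⁵ : 2 * (4 + K) ≤ k ^ 5
  2[4+K]≤k⁵ = *-^-≤ k 1 4 (4^-≤ 1 (m≤m+n 2 2)) (begin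
    4 + 12 * h ≤⟨ +-monoˡ-≤ (12 * h) (m≤m*n 4 h) ⟩
    4 * h + 12 * h ≡⟨ *-distribʳ-+ h 4 12 ⟨
    16 * h ≤⟨ *-^-≤ k 2 2 (4^-≤ 2 ≤-refl) h≤k² ⟩
    k ^ 4 ∎)

  2^t≤u : 2 ^ t ≤ u ^ 1
  2^t≤u = ^t-≤ 1 (4^-≤ 1 (m≤m+n 2 2))

  [4t]Ct≤ : (4 * t) C t ≤ u ^ 3
  [4t]Ct≤ = ≤-trans (C-bound 4 t t) (*-^-≤ u 2 1 (^t-≤ 2 (4^-≤ 2 (m≤m+n 8 8))) 2^t≤u)

  [Kt]Ct≤ : (K * t) C t ≤ u ^ 6
  [Kt]Ct≤ = ≤-trans (C-bound K t t) (*-^-≤ u 5 1 (^t-≤ 5 2K≤k⁵) 2^t≤u)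

  ℓ≤ : ℓ ≤ u ^ 21
  ℓ≤ = begin
    (4 * t + K * t) C (4 * t) ≡⟨ cong (_C (4 * t)) (*-distribʳ-+ t 4 K) ⟨
    ((4 + K) * t) C (4 * t) ≤⟨ C-bound (4 + K) t (4 * t) ⟩
    (2 * (4 + K)) ^ (4 * t) * 2 ^ t ≤⟨ *-^-≤ u 20 1 base 2^t≤u ⟩
    u ^ 21 ∎
    where
    base : (2 * (4 + K)) ^ (4 * t) ≤ u ^ 20
    base = begin
      (2 * (4 + K)) ^ (4 * t) ≡⟨ ^-*-assoc (2 * (4 + K)) 4 t ⟨
      ((2 * (4 + K)) ^ 4) ^ t ≤⟨ ^t-≤ 20 (≤-trans (^-monoˡ-≤ 4 2[4+K]≤k⁵) (≤-reflexive (^-*-assoc k 5 4))) ⟩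
      u ^ 20 ∎

  L≤ : L ≤ u ^ 32
  L≤ = *-^-≤ u 4 28 (≤u 4 K≤k⁴) (begin
    ((K * t) C t) * ℓ + ℓ ≤⟨ +-mono-≤ (*-^-≤ u 6 21 [Kt]Ct≤ ℓ≤) (≤-trans ℓ≤ (^-monoʳ-≤ u (m≤m+n 21 6))) ⟩
    u ^ 27 + u ^ 27 ≡⟨ cong (u ^ 27 +_) (+-identityʳ (u ^ 27)) ⟨
    2 * u ^ 27 ≤⟨ *-^-≤ u 1 27 (≤u 1 (4^-≤ 1 (m≤m+n 2 2))) ≤-refl ⟩
    u ^ 28 ∎)

  threshold-≤ : suc h * (3 + (4 * (((4 * t) C t) * L) + 4 * L)) ≤ k ^ (39 * t)
  threshold-≤ = begin
    suc h * (3 + (4 * (((4 * t) C t) * L) + 4 * L))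
      -- Exponents of `u`: 32 for `L` and 3 for the binomial coefficient, then 2 for the constant 11
      -- and 2 for `suc h`, in total 39.
      ≤⟨ *-monoʳ-≤ (suc h) (+-mono-≤ (m≤m*n 3 (u ^ 35) {{m^n≢0 u 35}})
          (+-mono-≤ (*-monoʳ-≤ 4 (*-^-≤ u 3 32 [4t]Ct≤ L≤))
            (*-monoʳ-≤ 4 (≤-trans L≤ (^-monoʳ-≤ u (m≤m+n 32 3)))))) ⟩
    suc h * (3 * u ^ 35 + (4 * u ^ 35 + 4 * u ^ 35)) ≡⟨ cong (suc h *_) (identity (u ^ 35)) ⟩
    suc h * (11 * u ^ 35)
      ≤⟨ *-^-≤ u 2 37 (≤u 2 suc-h≤k²) (*-^-≤ u 2 35 (≤u 2 (4^-≤ 2 (m≤m+n 11 5))) ≤-refl) ⟩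
    u ^ 39 ≡⟨ ^-*-assoc k t 39 ⟩
    k ^ (t * 39) ≡⟨ cong (k ^_) (*-comm t 39) ⟩
    k ^ (39 * t) ∎
    where
    identity : ∀ x → 3 * x + (4 * x + 4 * x) ≡ 11 * x
    identity = solve-∀

  ℓ≥1 : 1 ≤ ℓ
  ℓ≥1 = C-positive (m≤m+n (4 * t) (K * t))

  K*ℓ≤L : K * ℓ ≤ L
  K*ℓ≤L = *-monoʳ-≤ K (m≤n+m ℓ _)

  L≥1 : 1 ≤ L
  L≥1 = ≤-trans (*-mono-≤ {1} {K} (s≤s z≤n) ℓ≥1) K*ℓ≤L

-- From lists of vertices to subsets.

Pattern : ∀ {n} → Colouring n → ℕ → Set
Pattern {n} c t = ∃[ P ] ∃[ Q ] ∃[ col ]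
  ((∀ i → i ∈ P → i ∉ Q) × ∣ P ∣ ≡ t × ∣ Q ∣ ≡ t ×
   (∀ i j → i ∈ P → j ∈ Q → c i j ≡ col) ×
   (∀ i j → i ∈ P → j ∈ P → i ≢ j → c i j ≡ not col) ×
   (∀ i j → i ∈ Q → j ∈ Q → i ≢ j → c i j ≡ not col))

-- Finite search, which removes the double negation under which the pattern is found.
Pattern? : ∀ {n} (c : Colouring n) t → Dec (Pattern c t)
Pattern? {n} c t = anySubset? λ P → anySubset? λ Q → anyBool? λ col →
    all? (λ i → i ∈? P →-dec ¬? (i ∈? Q)) ×-dec ∣ P ∣ ≟ⁿ t ×-dec ∣ Q ∣ ≟ⁿ t ×-dec
    all? (λ i → all? λ j → i ∈? P →-dec j ∈? Q →-dec (c i j ≟ᵇ col)) ×-dec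
    clique? P col ×-dec clique? Q col
  where
  anyBool? : ∀ {R : Bool → Set} → Decidable R → Dec (∃[ b ] R b)
  anyBool? R? = map′
    (λ { (inj₁ r) → true , r ; (inj₂ r) → false , r })
    (λ { (true , r) → inj₁ r ; (false , r) → inj₂ r })
    (R? true ⊎-dec R? false)
  clique? : ∀ (P : Subset n) col → Dec (∀ i j → i ∈ P → j ∈ P → i ≢ j → c i j ≡ not col)
  clique? P col = all? λ i → all? λ j →
    i ∈? P →-dec j ∈? P →-dec ¬? (i ≟ j) →-dec (c i j ≟ᵇ not col)

toSubset : ∀ {n} → List (Fin n) → Subset n
toSubset [] = ∅
toSubset (x ∷ xs) = ⁅ x ⁆ ∪ toSubset xs

toSubset⁻ : ∀ {n} {i : Fin n} xs → i ∈ toSubset xs → i ∈ˡ xs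
toSubset⁻ [] i∈ = ⊥-elim (∉⊥ i∈)
toSubset⁻ (x ∷ xs) i∈ with x∈p∪q⁻ ⁅ x ⁆ (toSubset xs) i∈
... | inj₁ i∈x = here (x∈⁅y⁆⇒x≡y x i∈x)
... | inj₂ i∈xs = there (toSubset⁻ xs i∈xs)

∣⁅x⁆∪p∣ : ∀ {n} (x : Fin n) p → x ∉ p → ∣ ⁅ x ⁆ ∪ p ∣ ≡ suc ∣ p ∣
∣⁅x⁆∪p∣ fzero (true Vec.∷ p) x∉p = contradiction Vec.here x∉p
∣⁅x⁆∪p∣ fzero (false Vec.∷ p) x∉p = cong (suc ∘ ∣_∣) (∪-identityˡ p)
∣⁅x⁆∪p∣ (fsuc x) (true Vec.∷ p) x∉p = cong suc (∣⁅x⁆∪p∣ x p (x∉p ∘ Vec.there))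
∣⁅x⁆∪p∣ (fsuc x) (false Vec.∷ p) x∉p = ∣⁅x⁆∪p∣ x p (x∉p ∘ Vec.there)

∣toSubset∣ : ∀ {n} {xs : List (Fin n)} → Unique xs → ∣ toSubset xs ∣ ≡ length xs
∣toSubset∣ {n} [] = ∣⊥∣≡0 n
∣toSubset∣ {xs = x ∷ xs} (x∉ ∷ u) =
  trans (∣⁅x⁆∪p∣ x (toSubset xs) λ x∈ → All.lookup x∉ (toSubset⁻ xs x∈) refl) (cong suc (∣toSubset∣ u))

module _ {n : ℕ} (c : Colouring n) (c-sym : IsSymmetric c) where

  open Edges c c-sym

  Clique-lookup : ∀ {b P i j} → Clique b P → i ∈ˡ P → j ∈ˡ P → i ≢ j → c i j ≡ b
  Clique-lookup (_ ∷ _) (here refl) (here refl) i≢j = contradiction refl i≢j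
  Clique-lookup (a ∷ _) (here refl) (there j∈) _ = proj₂ (All.lookup a j∈)
  Clique-lookup (a ∷ _) (there i∈) (here refl) _ = proj₂ (Adj-sym (All.lookup a i∈))
  Clique-lookup (_ ∷ cl) (there i∈) (there j∈) i≢j = Clique-lookup cl i∈ j∈ i≢j

  Clique⇒Unique : ∀ {b P} → Clique b P → Unique P
  Clique⇒Unique = AllPairs.map (≢-sym ∘ proj₁)

  toPattern : ∀ {t} b {P Q} → length P ≡ t → length Q ≡ t →
    Clique (not b) P → Clique (not b) Q → Complete b P Q → Pattern c t
  toPattern b {P} {Q} |P| |Q| clP clQ com =
    toSubset P , toSubset Q , b ,
    -- Adjacent vertices are distinct, so completeness between `P` and `Q` already makes them
    -- disjoint.
    (λ i i∈P i∈Q → proj₁ (All.lookup (All.lookup com (toSubset⁻ P i∈P)) (toSubset⁻ Q i∈Q)) refl) ,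
    trans (∣toSubset∣ (Clique⇒Unique clP)) |P| ,
    trans (∣toSubset∣ (Clique⇒Unique clQ)) |Q| ,
    (λ i j i∈P j∈Q → proj₂ (All.lookup (All.lookup com (toSubset⁻ P i∈P)) (toSubset⁻ Q j∈Q))) ,
    (λ i j i∈P j∈P → Clique-lookup clP (toSubset⁻ P i∈P) (toSubset⁻ P j∈P)) ,
    (λ i j i∈Q j∈Q → Clique-lookup clQ (toSubset⁻ Q i∈Q) (toSubset⁻ Q j∈Q))

-- The degree hypothesis for rational ε = p/q, and the conclusion.

-- Since 1/h ≤ p/q, the excess ε n may be lowered to n/h. The witness `x` is `4 * d` minus `n`,
-- which avoids subtraction.
degree-bound : ∀ {p q h n d} → 0 < p → 0 < q → q ≤ h * p →
  q * n + 4 * p * n ≤ 4 * q * d → (h + 4) * n ≤ 4 * h * d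
degree-bound {p} {q} {h} {n} {d} 0<p 0<q q≤hp le
  with m≤n⇒∃[o]m+o≡n (*-cancelˡ-≤ q {{>-nonZero 0<q}}
         (≤-trans (m≤m+n (q * n) (4 * p * n)) (≤-trans le (≤-reflexive (identity q d)))))
  where
  identity : ∀ q d → 4 * q * d ≡ q * (4 * d)
  identity = solve-∀
... | x , n+x≡4d = begin
    (h + 4) * n ≡⟨ *-distribʳ-+ n h 4 ⟩
    h * n + 4 * n ≤⟨ +-monoʳ-≤ (h * n) 4n≤hx ⟩
    h * n + h * x ≡⟨ *-distribˡ-+ h n x ⟨
    h * (n + x) ≡⟨ cong (h *_) n+x≡4d ⟩
    h * (4 * d) ≡⟨ identity₁ h d ⟩
    4 * h * d ∎
  where
  open ≤-Reasoning
  identity₁ : ∀ h d → h * (4 * d) ≡ 4 * h * d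
  identity₁ = solve-∀
  identity₂ : ∀ p n → p * (4 * n) ≡ 4 * p * n
  identity₂ = solve-∀
  identity₃ : ∀ h p x → h * p * x ≡ p * (h * x)
  identity₃ = solve-∀
  4n≤hx : 4 * n ≤ h * x
  4n≤hx = *-cancelˡ-≤ p {{>-nonZero 0<p}} (begin
    p * (4 * n) ≡⟨ identity₂ p n ⟩
    4 * p * n ≤⟨ +-cancelˡ-≤ (q * n) _ _ (≤-trans le (≤-reflexive
      (trans (sym (identity₁ q d)) (trans (cong (q *_) (sym n+x≡4d)) (*-distribˡ-+ q n x))))) ⟩
    q * x ≤⟨ *-monoˡ-≤ x q≤hp ⟩
    h * p * x ≡⟨ identity₃ h p x ⟩
    p * (h * x) ∎)

theorem1 : ∃[ C ] (1 ≤ C × (∀ (p q t n : ℕ) → 0 < p → 4 * p < q → 1 ≤ t → 1 ≤ n →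
    q ^ (C * t) < n * p ^ (C * t) →
    (c : Colouring n) → IsSymmetric c →
    (∀ (b : Bool) (v : Fin n) → q * n + 4 * p * n ≤ 4 * q * degree c b v) →
    ∃[ P ] ∃[ Q ] ∃[ col ]
    ((∀ i → i ∈ P → i ∉ Q) × ∣ P ∣ ≡ t × ∣ Q ∣ ≡ t ×
    (∀ i j → i ∈ P → j ∈ Q → c i j ≡ col) ×
    (∀ i j → i ∈ P → j ∈ P → i ≢ j → c i j ≡ not col) ×
    (∀ i j → i ∈ Q → j ∈ Q → i ≢ j → c i j ≡ not col))))
-- The constant is the exponent reached in `threshold-≤`.
theorem1 = 39 , s≤s z≤n , λ p q t n 0<p 4p<q 1≤t _ large c c-sym min-deg →
  decidable-stable (Pattern? c t) (go p q t n 0<p 4p<q 1≤t large c c-sym min-deg)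
  where
  go : ∀ p q t n → 0 < p → 4 * p < q → 1 ≤ t → q ^ (39 * t) < n * p ^ (39 * t) →
    (c : Colouring n) → IsSymmetric c →
    (∀ (b : Bool) (v : Fin n) → q * n + 4 * p * n ≤ 4 * q * degree c b v) → ¬ ¬ Pattern c t
  go p q t n 0<p 4p<q 1≤t large c c-sym min-deg no-pattern =
    contradiction-from-degrees refl (≤-trans threshold-≤ (<⇒≤ k^N<n))
      (λ b v → degree-bound {h = suc k} 0<p (≤-trans (s≤s z≤n) 4p<q) q≤hp (min-deg b v))
    where
    instance
      p≢0 : NonZero p
      p≢0 = >-nonZero 0<p
    k = q / p
    N = 39 * t
    4≤k : 4 ≤ k
    4≤k = ≤-trans (≤-reflexive (sym (m*n/n≡m 4 p))) (/-monoˡ-≤ p (<⇒≤ 4p<q))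
    q≤hp : q ≤ suc k * p
    q≤hp = ≤-trans (≤-reflexive (m≡m%n+[m/n]*n q p)) (+-monoˡ-≤ (k * p) (<⇒≤ (m%n<n q p)))
    -- From `k * p ≤ q`: rounding 1/ε down to `k` only weakens the lower bound on `n`.
    k^N<n : k ^ N < n
    k^N<n = *-cancelʳ-< (p ^ N) (k ^ N) n (≤-<-trans
      (≤-trans (≤-reflexive (sym (^-distrib-* k p N))) (^-monoˡ-≤ N (m/n*n≤m q p))) large)
    open Size k t 4≤k 1≤t
    open NoPattern c c-sym t 1≤t
      (λ b |P| |Q| clP clQ com → no-pattern (toPattern c c-sym b |P| |Q| clP clQ com))
    open Blocks K ℓ L (s≤s z≤n) L≥1 ≤-refl (*-monoʳ-≤ K (m≤m+n _ ℓ)) K*ℓ≤L
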